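{- Let $T$ be a recursively enumerable theory in the language of arithmetic extending Robinson's arithmetic $Q$ whose provability predicate $\mathrm{Pr}_T$ satisfies the Hilbert–Bernays–Löb derivability conditions. Then $T$ is sound if and only if every Gödelian sentence of $T$ is true in $\mathbb{N}$.
   Context: $\mathbb{N}$ is the standard model of arithmetic; $T$ is sound iff every $T$-provable sentence is true in $\mathbb{N}$. For a formula $\sigma$, $\#\sigma$ denotes the canonical numeral for the Gödel number of $\sigma$, and $\mathrm{Pr}_T(x)$ is an arithmetized provability predicate for $T$ with $\mathbb{N}\vDash\mathrm{Pr}_T(\#\sigma)$ iff $T\vdash\sigma$. A sentence $G$ is a Gödelian sentence of $T$ iff $T\vdash G\leftrightarrow\neg\mathrm{Pr}_T(\#G)$. The derivability conditions: (D1) if $T\vdash\sigma$ then $T\vdash\mathrm{Pr}_T(\#\sigma)$; (D2) $T\vdash\mathrm{Pr}_T(\#(\sigma\to\rho))\to(\mathrm{Pr}_T(\#\sigma)\to\mathrm{Pr}_T(\#\rho))$; (D3) $T\vdash\mathrm{Pr}_T(\#\sigma)\to\mathrm{Pr}_T(\#\mathrm{Pr}_T(\#\sigma))$. -}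

module Defs where

open import Data.Nat using (ℕ; zero; suc; _+_; _*_; _^_)
open import Data.Fin using (Fin; toℕ) renaming (zero to fz; suc to fs)
open import Data.Maybe using (Maybe; just)
open import Data.Product using (Σ; _×_; _,_)
open import Data.Empty using (⊥)
open import Relation.Binary.PropositionalEquality using (_≡_)
open import Function.Bundles using (_⇔_)

infixl 7 _⊗_
infixl 6 _⊕_
infix  5 _≐_
infixr 3 _⇒_
infix  2 _⇔̇_
infixr 4 _∧̇_ _∨̇_
infix  8 ¬̇_

data Term (n : ℕ) : Set where
  v   : Fin n → Term n
  𝟎   : Term n
  𝐒   : Term n → Term n
  _⊕_ : Term n → Term n → Term n
  _⊗_ : Term n → Term n → Term n

data Formula (n : ℕ) : Set where
  _≐_ : Term n → Term n → Formula n
  fls : Formula n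
  _⇒_ : Formula n → Formula n → Formula n
  all : Formula (suc n) → Formula n

Sentence : Set
Sentence = Formula 0

¬̇_ : ∀ {n} → Formula n → Formula n
¬̇ A = A ⇒ fls

_∨̇_ : ∀ {n} → Formula n → Formula n → Formula n
A ∨̇ B = (¬̇ A) ⇒ B

_∧̇_ : ∀ {n} → Formula n → Formula n → Formula n
A ∧̇ B = ¬̇ (A ⇒ ¬̇ B)

_⇔̇_ : ∀ {n} → Formula n → Formula n → Formula n
A ⇔̇ B = (A ⇒ B) ∧̇ (B ⇒ A)

ex : ∀ {n} → Formula (suc n) → Formula n
ex A = ¬̇ all (¬̇ A)

ext : ∀ {n m} → (Fin n → Fin m) → Fin (suc n) → Fin (suc m)
ext ρ fz     = fz
ext ρ (fs i) = fs (ρ i)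

renT : ∀ {n m} → (Fin n → Fin m) → Term n → Term m
renT ρ (v i)   = v (ρ i)
renT ρ 𝟎       = 𝟎
renT ρ (𝐒 t)   = 𝐒 (renT ρ t)
renT ρ (s ⊕ t) = renT ρ s ⊕ renT ρ t
renT ρ (s ⊗ t) = renT ρ s ⊗ renT ρ t

renF : ∀ {n m} → (Fin n → Fin m) → Formula n → Formula m
renF ρ (s ≐ t) = renT ρ s ≐ renT ρ t
renF ρ fls     = fls
renF ρ (A ⇒ B) = renF ρ A ⇒ renF ρ B
renF ρ (all A) = all (renF (ext ρ) A)

exts : ∀ {n m} → (Fin n → Term m) → Fin (suc n) → Term (suc m)
exts σ fz     = v fz
exts σ (fs i) = renT fs (σ i)

subT : ∀ {n m} → (Fin n → Term m) → Term n → Term m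
subT σ (v i)   = σ i
subT σ 𝟎       = 𝟎
subT σ (𝐒 t)   = 𝐒 (subT σ t)
subT σ (s ⊕ t) = subT σ s ⊕ subT σ t
subT σ (s ⊗ t) = subT σ s ⊗ subT σ t

subF : ∀ {n m} → (Fin n → Term m) → Formula n → Formula m
subF σ (s ≐ t) = subT σ s ≐ subT σ t
subF σ fls     = fls
subF σ (A ⇒ B) = subF σ A ⇒ subF σ B
subF σ (all A) = all (subF (exts σ) A)

_[_]₀ : ∀ {n} → Formula (suc n) → Term n → Formula n
A [ t ]₀ = subF (λ { fz → t ; (fs i) → v i }) A

wk : ∀ {n} → Formula n → Formula (suc n)
wk = renF fs

close : ∀ {n} → Sentence → Formula n
close = renF (λ ())

num : ∀ {n} → ℕ → Term n
num zero    = 𝟎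
num (suc k) = 𝐒 (num k)

-- injective pairing  ⟨a,b⟩ = 2^a · (2b+1)
pair : ℕ → ℕ → ℕ
pair a b = 2 ^ a * suc (2 * b)

gT : ∀ {n} → Term n → ℕ
gT (v i)   = pair 0 (toℕ i)
gT 𝟎       = pair 1 0
gT (𝐒 t)   = pair 2 (gT t)
gT (s ⊕ t) = pair 3 (pair (gT s) (gT t))
gT (s ⊗ t) = pair 4 (pair (gT s) (gT t))

♯ : ∀ {n} → Formula n → ℕ
♯ (s ≐ t) = pair 0 (pair (gT s) (gT t))
♯ fls     = pair 1 0
♯ (A ⇒ B) = pair 2 (pair (♯ A) (♯ B))
♯ (all A) = pair 3 (♯ A)

_⟨_⟩ : Formula 1 → Sentence → Sentence
P ⟨ σ ⟩ = P [ num (♯ σ) ]₀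

Theory : Set₁
Theory = Sentence → Set   -- the set of (non-logical) axioms

infix 1 _⊢_

data _⊢_ (T : Theory) : ∀ {n} → Formula n → Set where
  ax    : ∀ {n} {φ : Sentence} → T φ → T ⊢ close {n} φ
  axK   : ∀ {n} (A B : Formula n) → T ⊢ A ⇒ B ⇒ A
  axS   : ∀ {n} (A B C : Formula n) → T ⊢ (A ⇒ B ⇒ C) ⇒ (A ⇒ B) ⇒ A ⇒ C
  axDNE : ∀ {n} (A : Formula n) → T ⊢ ¬̇ ¬̇ A ⇒ A
  mp    : ∀ {n} {A B : Formula n} → T ⊢ A ⇒ B → T ⊢ A → T ⊢ B
  gen   : ∀ {n} {A : Formula (suc n)} → T ⊢ A → T ⊢ all A
  axInst : ∀ {n} (A : Formula (suc n)) (t : Term n) → T ⊢ all A ⇒ A [ t ]₀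
  axAllImp : ∀ {n} (A : Formula n) (B : Formula (suc n)) →
             T ⊢ all (wk A ⇒ B) ⇒ A ⇒ all B
  axRefl : ∀ {n} (t : Term n) → T ⊢ t ≐ t
  axSubst : ∀ {n} (A : Formula (suc n)) (s t : Term n) →
            T ⊢ s ≐ t ⇒ A [ s ]₀ ⇒ A [ t ]₀

_∷ₑ_ : ∀ {n} → ℕ → (Fin n → ℕ) → Fin (suc n) → ℕ
(a ∷ₑ e) fz     = a
(a ∷ₑ e) (fs i) = e i

evalT : ∀ {n} → Term n → (Fin n → ℕ) → ℕ
evalT (v i)   e = e i
evalT 𝟎       e = 0
evalT (𝐒 t)   e = suc (evalT t e)
evalT (s ⊕ t) e = evalT s e + evalT t e
evalT (s ⊗ t) e = evalT s e * evalT t e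

Sat : ∀ {n} → Formula n → (Fin n → ℕ) → Set
Sat (s ≐ t) e = evalT s e ≡ evalT t e
Sat fls     e = ⊥
Sat (A ⇒ B) e = Sat A e → Sat B e
Sat (all A) e = (a : ℕ) → Sat A (a ∷ₑ e)

True : Sentence → Set
True σ = Sat σ (λ ())

x₀ x₁ : ∀ {n} → Term (suc (suc n))
x₀ = v fz
x₁ = v (fs fz)

data QAx : Sentence → Set where
  q1 : QAx (all (¬̇ (𝐒 (v fz) ≐ 𝟎)))
  q2 : QAx (all (all (𝐒 x₁ ≐ 𝐒 x₀ ⇒ x₁ ≐ x₀)))
  q3 : QAx (all ((v fz ≐ 𝟎) ∨̇ ex (x₁ ≐ 𝐒 x₀)))
  q4 : QAx (all (v fz ⊕ 𝟎 ≐ v fz))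
  q5 : QAx (all (all (x₁ ⊕ 𝐒 x₀ ≐ 𝐒 (x₁ ⊕ x₀))))
  q6 : QAx (all (v fz ⊗ 𝟎 ≐ 𝟎))
  q7 : QAx (all (all (x₁ ⊗ 𝐒 x₀ ≐ (x₁ ⊗ x₀) ⊕ x₁)))

ExtendsQ : Theory → Set
ExtendsQ T = ∀ {φ} → QAx φ → T ⊢ φ

-- recursively enumerable: the axiom set is the range of a
-- (computable, being an Agda function) enumeration
RecEnum : Theory → Set
RecEnum T = Σ (ℕ → Maybe Sentence) λ f → ∀ φ → T φ ⇔ Σ ℕ (λ k → f k ≡ just φ)

IsProvPred : Theory → Formula 1 → Set
IsProvPred T Pr = ∀ σ → True (Pr ⟨ σ ⟩) ⇔ (T ⊢ σ)

D1 : Theory → Formula 1 → Set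
D1 T Pr = ∀ σ → T ⊢ σ → T ⊢ Pr ⟨ σ ⟩

D2 : Theory → Formula 1 → Set
D2 T Pr = ∀ σ ρ → T ⊢ Pr ⟨ σ ⇒ ρ ⟩ ⇒ Pr ⟨ σ ⟩ ⇒ Pr ⟨ ρ ⟩

D3 : Theory → Formula 1 → Set
D3 T Pr = ∀ σ → T ⊢ Pr ⟨ σ ⟩ ⇒ Pr ⟨ Pr ⟨ σ ⟩ ⟩

Sound : Theory → Set
Sound T = ∀ σ → T ⊢ σ → True σ

Godelian : Theory → Formula 1 → Sentence → Set
Godelian T Pr G = T ⊢ G ⇔̇ ¬̇ (Pr ⟨ G ⟩)

-- For ⇐: if T ⊢ σ and G is Gödelian, then D1 and D2 make G ∧ σ Gödelian as well, so it is true,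
-- and hence so is σ. What remains is the existence of a Gödelian sentence.
--
-- The fixed point is built without representing exponentiation or substitution in T. A guard
-- ∀x (e ≐ x → B) acts like an assignment x := e executed before B, and its code is an affine
-- function of the code b of B (with coefficients depending on e). Let `tick` be a block of
-- guards performing (x, y, z) := (x + 1, 1 + y + z y, z); its code is (c + 1) b + d. Started at
-- (0, 0, c), k ticks give x = k and y = ((c + 1)^k − 1) / c, and the code of `tick`^k H is
-- h + y (c h + d), where h is the code of H. Taking k = h, this is the value of the term
-- x + y (z x + d), which does not mention h. So H may be chosen as P applied to (a guarded
-- version of) that term, and the sentence "initialise; tick^h; H" says P of its own code.
-- T only has to evaluate closed terms.

module Submission where

open import Defs
open import Data.Fin using (Fin; toℕ; _↑ˡ_) renaming (zero to fz; suc to fs)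
open import Data.Fin.Properties using (toℕ-↑ˡ)
open import Data.List using (List; []; _∷_)
open import Data.List.Membership.Propositional using (_∈_)
open import Data.List.Relation.Unary.Any using (here; there)
open import Data.Nat using (ℕ; zero; suc; _+_; _*_; _^_; _≟_)
open import Data.Nat.GeneralisedArithmetic using (fold)
open import Data.Nat.Properties using (+-suc; +-comm; *-suc; +-identityʳ; *-zeroʳ)
open import Data.Nat.Tactic.RingSolver using (solve-∀)
open import Data.Product using (∃; ∃₂; _,_)
open import Function using (_∘_; id)
open import Function.Bundles using (_⇔_; mk⇔; Equivalence)
open import Relation.Binary.PropositionalEquality
  using (_≡_; refl; sym; trans; cong; cong₂; subst; subst₂; module ≡-Reasoning)
open import Relation.Nullary using (¬_)
open import Relation.Nullary.Decidable using (decidable-stable)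

-- Atoms are decidable, and `fls`, `_⇒_` and `all` preserve stability, so truth can be proved by
-- contradiction in a constructive metatheory.
Sat-stable : ∀ {n} (A : Formula n) e → ¬ ¬ Sat A e → Sat A e
Sat-stable (s ≐ t) e ¬¬a = decidable-stable (evalT s e ≟ evalT t e) ¬¬a
Sat-stable fls     e ¬¬a = ¬¬a id
Sat-stable (A ⇒ B) e ¬¬a a = Sat-stable B e λ ¬b → ¬¬a λ f → ¬b (f a)
Sat-stable (all A) e ¬¬a k = Sat-stable A (k ∷ₑ e) λ ¬a → ¬¬a λ f → ¬a (f k)

-- Substitution

Subst : ℕ → ℕ → Set
Subst n m = Fin n → Term m

_∷ₛ_ : ∀ {n m} → Term m → Subst n m → Subst (suc n) m
(t ∷ₛ σ) fz     = t
(t ∷ₛ σ) (fs i) = σ i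

exts-cong : ∀ {n m} {σ τ : Subst n m} → (∀ i → σ i ≡ τ i) → ∀ i → exts σ i ≡ exts τ i
exts-cong eq fz     = refl
exts-cong eq (fs i) = cong (renT fs) (eq i)

subT-cong : ∀ {n m} {σ τ : Subst n m} → (∀ i → σ i ≡ τ i) → ∀ t → subT σ t ≡ subT τ t
subT-cong eq (v i)   = eq i
subT-cong eq 𝟎       = refl
subT-cong eq (𝐒 t)   = cong 𝐒 (subT-cong eq t)
subT-cong eq (s ⊕ t) = cong₂ _⊕_ (subT-cong eq s) (subT-cong eq t)
subT-cong eq (s ⊗ t) = cong₂ _⊗_ (subT-cong eq s) (subT-cong eq t)

subF-cong : ∀ {n m} {σ τ : Subst n m} → (∀ i → σ i ≡ τ i) → ∀ A → subF σ A ≡ subF τ A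
subF-cong eq (s ≐ t) = cong₂ _≐_ (subT-cong eq s) (subT-cong eq t)
subF-cong eq fls     = refl
subF-cong eq (A ⇒ B) = cong₂ _⇒_ (subF-cong eq A) (subF-cong eq B)
subF-cong eq (all A) = cong all (subF-cong (exts-cong eq) A)

subT-renT : ∀ {n m k} (σ : Subst m k) (ρ : Fin n → Fin m) t →
            subT σ (renT ρ t) ≡ subT (σ ∘ ρ) t
subT-renT σ ρ (v i)   = refl
subT-renT σ ρ 𝟎       = refl
subT-renT σ ρ (𝐒 t)   = cong 𝐒 (subT-renT σ ρ t)
subT-renT σ ρ (s ⊕ t) = cong₂ _⊕_ (subT-renT σ ρ s) (subT-renT σ ρ t)
subT-renT σ ρ (s ⊗ t) = cong₂ _⊗_ (subT-renT σ ρ s) (subT-renT σ ρ t)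

renT-subT : ∀ {n m k} (ρ : Fin m → Fin k) (σ : Subst n m) t →
            renT ρ (subT σ t) ≡ subT (renT ρ ∘ σ) t
renT-subT ρ σ (v i)   = refl
renT-subT ρ σ 𝟎       = refl
renT-subT ρ σ (𝐒 t)   = cong 𝐒 (renT-subT ρ σ t)
renT-subT ρ σ (s ⊕ t) = cong₂ _⊕_ (renT-subT ρ σ s) (renT-subT ρ σ t)
renT-subT ρ σ (s ⊗ t) = cong₂ _⊗_ (renT-subT ρ σ s) (renT-subT ρ σ t)

subT-v : ∀ {n} (t : Term n) → subT v t ≡ t
subT-v (v i)   = refl
subT-v 𝟎       = refl
subT-v (𝐒 t)   = cong 𝐒 (subT-v t)
subT-v (s ⊕ t) = cong₂ _⊕_ (subT-v s) (subT-v t)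
subT-v (s ⊗ t) = cong₂ _⊗_ (subT-v s) (subT-v t)

subF-v : ∀ {n} (A : Formula n) → subF v A ≡ A
subF-v (s ≐ t) = cong₂ _≐_ (subT-v s) (subT-v t)
subF-v fls     = refl
subF-v (A ⇒ B) = cong₂ _⇒_ (subF-v A) (subF-v B)
subF-v (all A) = cong all (trans (subF-cong (λ { fz → refl ; (fs i) → refl }) A) (subF-v A))

exts-wk : ∀ {n m} (σ : Subst n m) t → subT (exts σ) (renT fs t) ≡ renT fs (subT σ t)
exts-wk σ t = trans (subT-renT (exts σ) fs t) (sym (renT-subT fs σ t))

subT-subT : ∀ {n m k} (τ : Subst m k) (σ : Subst n m) t →
            subT τ (subT σ t) ≡ subT (subT τ ∘ σ) t
subT-subT τ σ (v i)   = refl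
subT-subT τ σ 𝟎       = refl
subT-subT τ σ (𝐒 t)   = cong 𝐒 (subT-subT τ σ t)
subT-subT τ σ (s ⊕ t) = cong₂ _⊕_ (subT-subT τ σ s) (subT-subT τ σ t)
subT-subT τ σ (s ⊗ t) = cong₂ _⊗_ (subT-subT τ σ s) (subT-subT τ σ t)

subF-subF : ∀ {n m k} (τ : Subst m k) (σ : Subst n m) A →
            subF τ (subF σ A) ≡ subF (subT τ ∘ σ) A
subF-subF τ σ (s ≐ t) = cong₂ _≐_ (subT-subT τ σ s) (subT-subT τ σ t)
subF-subF τ σ fls     = refl
subF-subF τ σ (A ⇒ B) = cong₂ _⇒_ (subF-subF τ σ A) (subF-subF τ σ B)
subF-subF τ σ (all A) = cong all (trans (subF-subF (exts τ) (exts σ) A)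
  (subF-cong (λ { fz → refl ; (fs i) → exts-wk τ (σ i) }) A))

renT≡subT : ∀ {n m} (ρ : Fin n → Fin m) t → renT ρ t ≡ subT (v ∘ ρ) t
renT≡subT ρ t = trans (sym (subT-v (renT ρ t))) (subT-renT v ρ t)

renF≡subF : ∀ {n m} (ρ : Fin n → Fin m) A → renF ρ A ≡ subF (v ∘ ρ) A
renF≡subF ρ (s ≐ t) = cong₂ _≐_ (renT≡subT ρ s) (renT≡subT ρ t)
renF≡subF ρ fls     = refl
renF≡subF ρ (A ⇒ B) = cong₂ _⇒_ (renF≡subF ρ A) (renF≡subF ρ B)
renF≡subF ρ (all A) = cong all (trans (renF≡subF (ext ρ) A)
  (subF-cong (λ { fz → refl ; (fs i) → refl }) A))

subF-renF : ∀ {n m k} (σ : Subst m k) (ρ : Fin n → Fin m) A →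
            subF σ (renF ρ A) ≡ subF (σ ∘ ρ) A
subF-renF σ ρ A = trans (cong (subF σ) (renF≡subF ρ A)) (subF-subF σ (v ∘ ρ) A)

renF-subF : ∀ {n m k} (ρ : Fin m → Fin k) (σ : Subst n m) A →
            renF ρ (subF σ A) ≡ subF (renT ρ ∘ σ) A
renF-subF ρ σ A = trans (renF≡subF ρ (subF σ A)) (trans (subF-subF (v ∘ ρ) σ A)
  (subF-cong (λ i → sym (renT≡subT ρ (σ i))) A))

subT-num : ∀ {n m} (σ : Subst n m) k → subT σ (num k) ≡ num k
subT-num σ zero    = refl
subT-num σ (suc k) = cong 𝐒 (subT-num σ k)

-- The hypothesis on `σ` covers both `t ∷ₛ v` and the pattern-matching lambda in `_[_]₀`, which are
-- not definitionally equal.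
subT-wk : ∀ {n} {σ : Subst (suc n) n} → (∀ i → σ (fs i) ≡ v i) → ∀ t → subT σ (renT fs t) ≡ t
subT-wk eq t = trans (subT-renT _ fs t) (trans (subT-cong eq t) (subT-v t))

-- Propositional reasoning

infix 1 _﹐_⊩_

-- Generalisation is confined to `thm`, so the deduction theorem needs no side condition on
-- variables.
data _﹐_⊩_ (T : Theory) {n} (Γ : List (Formula n)) : Formula n → Set where
  hyp : ∀ {A} → A ∈ Γ → T ﹐ Γ ⊩ A
  thm : ∀ {A} → T ⊢ A → T ﹐ Γ ⊩ A
  _·_ : ∀ {A B} → T ﹐ Γ ⊩ A ⇒ B → T ﹐ Γ ⊩ A → T ﹐ Γ ⊩ B

infixl 9 _·_

-- Bracket abstraction into S and K; the identity is S K K, with `fls` an arbitrary filler.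
ƛ_ : ∀ {T n} {Γ : List (Formula n)} {A B} → T ﹐ A ∷ Γ ⊩ B → T ﹐ Γ ⊩ A ⇒ B
ƛ hyp (here refl)  = thm (axS _ _ _) · thm (axK _ _) · thm (axK _ fls)
ƛ hyp (there B∈Γ)  = thm (axK _ _) · hyp B∈Γ
ƛ thm b            = thm (axK _ _) · thm b
ƛ (f · a)          = thm (axS _ _ _) · (ƛ f) · (ƛ a)

infixr 0 ƛ_

run : ∀ {T n} {A : Formula n} → T ﹐ [] ⊩ A → T ⊢ A
run (hyp ())
run (thm a) = a
run (f · a) = mp (run f) (run a)

#0 : ∀ {T n} {Γ : List (Formula n)} {A} → T ﹐ A ∷ Γ ⊩ A
#0 = hyp (here refl)

#1 : ∀ {T n} {Γ : List (Formula n)} {A B} → T ﹐ B ∷ A ∷ Γ ⊩ A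
#1 = hyp (there (here refl))

#2 : ∀ {T n} {Γ : List (Formula n)} {A B C} → T ﹐ C ∷ B ∷ A ∷ Γ ⊩ A
#2 = hyp (there (there (here refl)))

exfalso : ∀ {T n} {Γ : List (Formula n)} {A} → T ﹐ Γ ⊩ fls → T ﹐ Γ ⊩ A
exfalso b = thm (axDNE _) · (thm (axK _ _) · b)

∧-intro : ∀ {T n} {A B : Formula n} → T ⊢ A ⇒ B ⇒ A ∧̇ B
∧-intro = run (ƛ ƛ ƛ #0 · #2 · #1)

∧-elimˡ : ∀ {T n} {A B : Formula n} → T ⊢ A ∧̇ B ⇒ A
∧-elimˡ = run (ƛ thm (axDNE _) · (ƛ #1 · (ƛ exfalso (#1 · #0))))

⇒-trans : ∀ {T n} {A B C : Formula n} → T ⊢ A ⇒ B → T ⊢ B ⇒ C → T ⊢ A ⇒ C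
⇒-trans f g = run (ƛ thm g · (thm f · #0))

contrapose : ∀ {T n} {A B : Formula n} → T ⊢ A ⇒ B → T ⊢ ¬̇ B ⇒ ¬̇ A
contrapose f = run (ƛ ƛ #1 · (thm f · #0))

infix 1 _⊢_↔_

record _⊢_↔_ (T : Theory) {n} (A B : Formula n) : Set where
  constructor iff
  field
    to   : T ⊢ A ⇒ B
    from : T ⊢ B ⇒ A

open _⊢_↔_

↔-refl : ∀ {T n} {A : Formula n} → T ⊢ A ↔ A
↔-refl = iff (run (ƛ #0)) (run (ƛ #0))

↔-trans : ∀ {T n} {A B C : Formula n} → T ⊢ A ↔ B → T ⊢ B ↔ C → T ⊢ A ↔ C
↔-trans (iff f g) (iff f′ g′) = iff (⇒-trans f f′) (⇒-trans g′ g)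

↔-¬ : ∀ {T n} {A B : Formula n} → T ⊢ A ↔ B → T ⊢ ¬̇ A ↔ ¬̇ B
↔-¬ (iff f g) = iff (contrapose g) (contrapose f)

↔⇒⇔̇ : ∀ {T n} {A B : Formula n} → T ⊢ A ↔ B → T ⊢ A ⇔̇ B
↔⇒⇔̇ (iff f g) = mp (mp ∧-intro f) g

-- Equality and evaluation of closed terms

leibniz : ∀ {T n} (A : Formula (suc n)) {s t} → T ⊢ s ≐ t → T ⊢ A [ s ]₀ → T ⊢ A [ t ]₀
leibniz A eq a = mp (mp (axSubst A _ _) eq) a

≐-sym : ∀ {T n} {s t : Term n} → T ⊢ s ≐ t → T ⊢ t ≐ s
≐-sym {T} {s = s} {t} eq = subst (λ u → T ⊢ t ≐ u) (subT-wk (λ _ → refl) s)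
  (leibniz (v fz ≐ renT fs s) eq
    (subst (λ u → T ⊢ s ≐ u) (sym (subT-wk (λ _ → refl) s)) (axRefl s)))

≐-trans : ∀ {T n} {s t u : Term n} → T ⊢ s ≐ t → T ⊢ t ≐ u → T ⊢ s ≐ u
≐-trans {T} {s = s} {t} {u} p q = subst (λ r → T ⊢ r ≐ u) (subT-wk (λ _ → refl) s)
  (leibniz (renT fs s ≐ v fz) q (subst (λ r → T ⊢ r ≐ t) (sym (subT-wk (λ _ → refl) s)) p))

≐-cong : ∀ {T n} (C : Term (suc n)) {s t : Term n} → T ⊢ s ≐ t →
         T ⊢ subT (s ∷ₛ v) C ≐ subT (t ∷ₛ v) C
≐-cong {T} C {s} {t} eq = subst₂ (λ a b → T ⊢ a ≐ b) (subT-wk (λ _ → refl) _)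
  (subT-cong (λ { fz → refl ; (fs i) → refl }) C)
  (leibniz (renT fs (subT (s ∷ₛ v) C) ≐ C) eq
    (subst₂ (λ a b → T ⊢ a ≐ b) (sym (subT-wk (λ _ → refl) _))
      (sym (subT-cong (λ { fz → refl ; (fs i) → refl }) C)) (axRefl _)))

𝐒-cong : ∀ {T n} {s t : Term n} → T ⊢ s ≐ t → T ⊢ 𝐒 s ≐ 𝐒 t
𝐒-cong = ≐-cong (𝐒 (v fz))

⊕-cong : ∀ {T n} {s t s′ t′ : Term n} → T ⊢ s ≐ s′ → T ⊢ t ≐ t′ → T ⊢ s ⊕ t ≐ s′ ⊕ t′
⊕-cong {T} {s = s} {t} {s′} {t′} p q = ≐-trans
  (subst₂ (λ a b → T ⊢ s ⊕ a ≐ s′ ⊕ b)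
    (subT-wk (λ _ → refl) t) (subT-wk (λ _ → refl) t) (≐-cong (v fz ⊕ renT fs t) p))
  (subst₂ (λ a b → T ⊢ a ⊕ t ≐ b ⊕ t′)
    (subT-wk (λ _ → refl) s′) (subT-wk (λ _ → refl) s′) (≐-cong (renT fs s′ ⊕ v fz) q))

⊗-cong : ∀ {T n} {s t s′ t′ : Term n} → T ⊢ s ≐ s′ → T ⊢ t ≐ t′ → T ⊢ s ⊗ t ≐ s′ ⊗ t′
⊗-cong {T} {s = s} {t} {s′} {t′} p q = ≐-trans
  (subst₂ (λ a b → T ⊢ s ⊗ a ≐ s′ ⊗ b)
    (subT-wk (λ _ → refl) t) (subT-wk (λ _ → refl) t) (≐-cong (v fz ⊗ renT fs t) p))
  (subst₂ (λ a b → T ⊢ a ⊗ t ≐ b ⊗ t′)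
    (subT-wk (λ _ → refl) s′) (subT-wk (λ _ → refl) s′) (≐-cong (renT fs s′ ⊗ v fz) q))

≡⇒≐ : ∀ {T n} {s t : Term n} → s ≡ t → T ⊢ s ≐ t
≡⇒≐ refl = axRefl _

module _ {T : Theory} (Q : ExtendsQ T) where

  ⊕-𝟎 : ∀ (s : Term 0) → T ⊢ s ⊕ 𝟎 ≐ s
  ⊕-𝟎 s = mp (axInst _ s) (Q q4)

  ⊗-𝟎 : ∀ (s : Term 0) → T ⊢ s ⊗ 𝟎 ≐ 𝟎
  ⊗-𝟎 s = mp (axInst _ s) (Q q6)

  ⊕-𝐒 : ∀ (s t : Term 0) → T ⊢ s ⊕ 𝐒 t ≐ 𝐒 (s ⊕ t)
  ⊕-𝐒 s t = subst (λ r → T ⊢ r ⊕ 𝐒 t ≐ 𝐒 (r ⊕ t)) (subT-wk (λ _ → refl) s)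
    (mp (axInst _ t) (mp (axInst _ s) (Q q5)))

  ⊗-𝐒 : ∀ (s t : Term 0) → T ⊢ s ⊗ 𝐒 t ≐ (s ⊗ t) ⊕ s
  ⊗-𝐒 s t = subst (λ r → T ⊢ r ⊗ 𝐒 t ≐ (r ⊗ t) ⊕ r) (subT-wk (λ _ → refl) s)
    (mp (axInst _ t) (mp (axInst _ s) (Q q7)))

  num-+ : ∀ a b → T ⊢ num {0} a ⊕ num b ≐ num (a + b)
  num-+ a zero    = ≐-trans (⊕-𝟎 _) (≡⇒≐ (cong num (sym (+-identityʳ a))))
  num-+ a (suc b) = ≐-trans (⊕-𝐒 _ _) (≐-trans (𝐒-cong (num-+ a b))
    (≡⇒≐ (cong num (sym (+-suc a b)))))

  num-* : ∀ a b → T ⊢ num {0} a ⊗ num b ≐ num (a * b)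
  num-* a zero    = ≐-trans (⊗-𝟎 _) (≡⇒≐ (cong num (sym (*-zeroʳ a))))
  num-* a (suc b) = ≐-trans (⊗-𝐒 _ _) (≐-trans (⊕-cong (num-* a b) (axRefl _))
    (≐-trans (num-+ (a * b) a)
      (≡⇒≐ (cong num (trans (+-comm (a * b) a) (sym (*-suc a b)))))))

  -- The induction takes place outside `T`: for each closed term, `T` only unwinds the recursion
  -- equations of addition and multiplication.
  eval-num : ∀ (t : Term 0) e → T ⊢ t ≐ num (evalT t e)
  eval-num (v ())  e
  eval-num 𝟎       e = axRefl 𝟎
  eval-num (𝐒 t)   e = 𝐒-cong (eval-num t e)
  eval-num (s ⊕ t) e = ≐-trans (⊕-cong (eval-num s e) (eval-num t e))
    (num-+ (evalT s e) (evalT t e))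
  eval-num (s ⊗ t) e = ≐-trans (⊗-cong (eval-num s e) (eval-num t e))
    (num-* (evalT s e) (evalT t e))

-- Self-reference

set_then_ : ∀ {n} → Term n → Formula (suc n) → Formula n
set e then B = all (renT fs e ≐ v fz ⇒ B)

-- Left to right, the bound variable is instantiated at `s`; right to left, Leibniz's law moves `B`
-- from `s` to any `x` equal to it. The environment `σ` is arbitrary, so that nested guards can be
-- run one after another.
subF-set : ∀ {T n m} (σ : Subst n m) (e : Term n) (B : Formula (suc n)) →
           T ⊢ subF σ (set e then B) ↔ subF (subT σ e ∷ₛ σ) B
subF-set {T} σ e B = iff
  (run (ƛ thm fwd · #0 · thm (axRefl s)))
  (mp (axAllImp _ _) (gen bwd))
  where
  s  = subT σ e
  s′ = subT (exts σ) (renT fs e)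
  B* = subF (s ∷ₛ σ) B

  [s]≡ : ∀ {τ : Subst _ _} → (∀ i → τ (fs i) ≡ v i) → subT τ s′ ≡ s
  [s]≡ eq = trans (cong (subT _) (exts-wk σ e)) (subT-wk eq s)

  B≡ : subF (exts σ) B [ s ]₀ ≡ B*
  B≡ = trans (subF-subF _ (exts σ) B)
    (subF-cong (λ { fz → refl ; (fs i) → subT-wk (λ _ → refl) (σ i) }) B)

  fwd : T ⊢ subF σ (set e then B) ⇒ s ≐ s ⇒ B*
  fwd = subst₂ (λ r C → T ⊢ subF σ (set e then B) ⇒ r ≐ s ⇒ C) ([s]≡ λ _ → refl) B≡ (axInst _ s)

  -- Template for Leibniz's law: index 0 is the hole, while the guard's variable has moved to index
  -- 1 and does not occur.
  A = subF (exts (renT fs ∘ σ)) B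

  A[s′] : A [ s′ ]₀ ≡ wk B*
  A[s′] = trans (subF-subF _ (exts (renT fs ∘ σ)) B) (trans
    (subF-cong (λ { fz → exts-wk σ e ; (fs i) → subT-wk (λ _ → refl) (renT fs (σ i)) }) B)
    (sym (renF-subF fs (s ∷ₛ σ) B)))

  A[v] : A [ v fz ]₀ ≡ subF (exts σ) B
  A[v] = trans (subF-subF _ (exts (renT fs ∘ σ)) B)
    (subF-cong (λ { fz → refl ; (fs i) → subT-wk (λ _ → refl) (renT fs (σ i)) }) B)

  bwd : T ⊢ wk B* ⇒ s′ ≐ v fz ⇒ subF (exts σ) B
  bwd = run (ƛ ƛ thm replace · #0 · #1)
    where
    replace : T ⊢ s′ ≐ v fz ⇒ wk B* ⇒ subF (exts σ) B
    replace = subst₂ (λ C D → T ⊢ s′ ≐ v fz ⇒ C ⇒ D) A[s′] A[v] (axSubst A s′ (v fz))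

-- Codes as affine functions

gT-ren : ∀ {n m} {ρ : Fin n → Fin m} → (∀ i → toℕ (ρ i) ≡ toℕ i) → ∀ t → gT (renT ρ t) ≡ gT t
gT-ren eq (v i)   = cong (pair 0) (eq i)
gT-ren eq 𝟎       = refl
gT-ren eq (𝐒 t)   = cong (pair 2) (gT-ren eq t)
gT-ren eq (s ⊕ t) = cong₂ (λ a b → pair 3 (pair a b)) (gT-ren eq s) (gT-ren eq t)
gT-ren eq (s ⊗ t) = cong₂ (λ a b → pair 4 (pair a b)) (gT-ren eq s) (gT-ren eq t)

-- Codes record variable indices but not the size of the context, so enlarging the context is
-- invisible to them.
♯-ren : ∀ {n m} {ρ : Fin n → Fin m} → (∀ i → toℕ (ρ i) ≡ toℕ i) → ∀ A → ♯ (renF ρ A) ≡ ♯ A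
♯-ren eq (s ≐ t) = cong₂ (λ a b → pair 0 (pair a b)) (gT-ren eq s) (gT-ren eq t)
♯-ren eq fls     = refl
♯-ren eq (A ⇒ B) = cong₂ (λ a b → pair 2 (pair a b)) (♯-ren eq A) (♯-ren eq B)
♯-ren eq (all A) = cong (pair 3) (♯-ren (λ { fz → refl ; (fs i) → cong suc (eq i) }) A)

-- The slope is kept as `suc c` because its excess `c` over 1 is what enters the geometric sum.
Affine : (ℕ → ℕ) → Set
Affine f = ∃₂ λ c d → ∀ b → f b ≡ suc c * b + d

affine-∘ : ∀ {f g} → Affine f → Affine g → Affine (f ∘ g)
affine-∘ (c , d , p) (c′ , d′ , q) = c + c′ + c * c′ , suc c * d′ + d , λ b →
  trans (p _) (trans (cong (λ x → suc c * x + d) (q b)) (lemma c d c′ d′ b))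
  where
  lemma : ∀ c d c′ d′ b →
          suc c * (suc c′ * b + d′) + d ≡ suc (c + c′ + c * c′) * b + (suc c * d′ + d)
  lemma = solve-∀

-- `pair a b` is `2 ^ suc a * b + 2 ^ a`; raising `a` by one doubles both coefficients.
pair-affine : ∀ a → Affine (pair a)
pair-affine zero    = 1 , 1 , lemma
  where
  lemma : ∀ b → 1 * suc (2 * b) ≡ 2 * b + 1
  lemma = solve-∀
pair-affine (suc a) with pair-affine a
... | c , d , p = suc (c + c) , d + d , λ b →
  trans (lemma₁ (2 ^ a) b) (trans (cong (λ x → x + x) (p b)) (lemma₂ c d b))
  where
  lemma₁ : ∀ P b → 2 * P * suc (2 * b) ≡ P * suc (2 * b) + P * suc (2 * b)
  lemma₁ = solve-∀
  lemma₂ : ∀ c d b → suc c * b + d + (suc c * b + d) ≡ suc (suc (c + c)) * b + (d + d)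
  lemma₂ = solve-∀

evalT-sub : ∀ {n m} (σ : Subst n m) e t → evalT (subT σ t) e ≡ evalT t (λ i → evalT (σ i) e)
evalT-sub σ e (v i)   = refl
evalT-sub σ e 𝟎       = refl
evalT-sub σ e (𝐒 t)   = cong suc (evalT-sub σ e t)
evalT-sub σ e (s ⊕ t) = cong₂ _+_ (evalT-sub σ e s) (evalT-sub σ e t)
evalT-sub σ e (s ⊗ t) = cong₂ _*_ (evalT-sub σ e s) (evalT-sub σ e t)

evalT-num : ∀ {n} k (e : Fin n → ℕ) → evalT (num k) e ≡ k
evalT-num zero    e = refl
evalT-num (suc k) e = cong suc (evalT-num k e)

-- Since `a` is fixed outside the language, `2 ^ a` enters as a numeral.
pairT : ∀ {n} → ℕ → Term n → Term n
pairT a t = num (2 ^ a) ⊗ 𝐒 (num 2 ⊗ t)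

evalT-pairT : ∀ {n} a (t : Term n) e → evalT (pairT a t) e ≡ pair a (evalT t e)
evalT-pairT a t e = cong (_* suc (2 * evalT t e)) (evalT-num (2 ^ a) e)

guardCode : ℕ → ℕ → ℕ
guardCode j b = pair 3 (pair 2 (pair j b))

guardCode-affine : ∀ j → Affine (guardCode j)
guardCode-affine j = affine-∘ (pair-affine 3) (affine-∘ (pair-affine 2) (pair-affine j))

guardCodeT : ∀ {n} → ℕ → Term n → Term n
guardCodeT j t = pairT 3 (pairT 2 (pairT j t))

evalT-guardCodeT : ∀ {n} j (t : Term n) e → evalT (guardCodeT j t) e ≡ guardCode j (evalT t e)
evalT-guardCodeT j t e = trans (evalT-pairT 3 (pairT 2 (pairT j t)) e) (cong (pair 3)
  (trans (evalT-pairT 2 (pairT j t) e) (cong (pair 2) (evalT-pairT j t e))))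

-- Opaque because the type checker would otherwise expand astronomically large powers of two.
opaque
  code : ∀ {n} → Formula n → ℕ
  code = ♯

  code≡♯ : ∀ {n} (A : Formula n) → code A ≡ ♯ A
  code≡♯ A = refl

  code-ren : ∀ {n m} {ρ : Fin n → Fin m} → (∀ i → toℕ (ρ i) ≡ toℕ i) →
             ∀ A → code (renF ρ A) ≡ code A
  code-ren = ♯-ren

  setCode : ∀ {n} → Term n → ℕ → ℕ
  setCode e = guardCode (♯ (renT fs e ≐ v fz))

  code-set : ∀ {n} (e : Term n) B → code (set e then B) ≡ setCode e (code B)
  code-set e B = refl

  setCode-affine : ∀ {n} (e : Term n) → Affine (setCode e)
  setCode-affine e = guardCode-affine (♯ (renT fs e ≐ v fz))

  setCodeT : ∀ {n m} → Term n → Term m → Term m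
  setCodeT e = guardCodeT (♯ (renT fs e ≐ v fz))

  evalT-setCodeT : ∀ {n m} (e : Term n) (t : Term m) ρ →
                   evalT (setCodeT e t) ρ ≡ setCode e (evalT t ρ)
  evalT-setCodeT e = evalT-guardCodeT (♯ (renT fs e ≐ v fz))

-- Registers and iterated ticks

fold-shift : ∀ {a} {A : Set a} (f : A → A) k x → fold (f x) f k ≡ f (fold x f k)
fold-shift f zero    x = refl
fold-shift f (suc k) x = cong f (fold-shift f k x)

set₃ : Term 3 → Term 4 → Term 5 → Formula 3 → Formula 3
set₃ e₁ e₂ e₃ B = set e₁ then set e₂ then set e₃ then renF (_↑ˡ 3) B

set₃-affine : ∀ e₁ e₂ e₃ → ∃₂ λ c d → ∀ B → code (set₃ e₁ e₂ e₃ B) ≡ suc c * code B + d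
set₃-affine e₁ e₂ e₃
  with affine-∘ (setCode-affine e₁) (affine-∘ (setCode-affine e₂) (setCode-affine e₃))
... | c , d , p = c , d , λ B → trans (code-set₃ B) (p (code B))
  where
  code-set₃ : ∀ B → code (set₃ e₁ e₂ e₃ B) ≡ setCode e₁ (setCode e₂ (setCode e₃ (code B)))
  code-set₃ B = trans (code-set e₁ _) (cong (setCode e₁) (trans (code-set e₂ _) (cong (setCode e₂)
    (trans (code-set e₃ _) (cong (setCode e₃) (code-ren (λ i → toℕ-↑ˡ i 3) B))))))

-- Index 2 denotes `z`, `y`, `x` in turn, as each guard already passed shifts the registers by one;
-- index 3 in `nextY` is the old `z`.
nextZ : Term 3
nextZ = v (fs (fs fz))

nextY : Term 4
nextY = 𝐒 (v (fs (fs fz)) ⊕ v (fs (fs (fs fz))) ⊗ v (fs (fs fz)))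

nextX : Term 5
nextX = 𝐒 (v (fs (fs fz)))

-- The registers (x , y , z) are v 0, v 1, v 2. As each guard binds a new v 0, they are assigned
-- in the order z, y, x, and _↑ˡ 3 then hides the old values without altering the code of B.
tick : Formula 3 → Formula 3
tick = set₃ nextZ nextY nextX

tick-affine : ∃₂ λ c d → ∀ B → code (tick B) ≡ suc c * code B + d
tick-affine = set₃-affine nextZ nextY nextX

next : ∀ {m} → Subst 3 m → Subst 3 m
next σ fz           = 𝐒 (σ fz)
next σ (fs fz)      = 𝐒 (σ (fs fz) ⊕ σ (fs (fs fz)) ⊗ σ (fs fz))
next σ (fs (fs fz)) = σ (fs (fs fz))

subF-set₃ : ∀ {T m} (σ : Subst 3 m) e₁ e₂ e₃ B →
            let σ₁ = subT σ e₁ ∷ₛ σ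
                σ₂ = subT σ₁ e₂ ∷ₛ σ₁
                σ₃ = subT σ₂ e₃ ∷ₛ σ₂
            in T ⊢ subF σ (set₃ e₁ e₂ e₃ B) ↔ subF (σ₃ ∘ (_↑ˡ 3)) B
subF-set₃ {T} {m} σ e₁ e₂ e₃ B = ↔-trans first (↔-trans second
  (subst (T ⊢ subF σ₂ (set e₃ then B′) ↔_) (subF-renF σ₃ (_↑ˡ 3) B) (subF-set σ₂ e₃ B′)))
  where
  B′ : Formula 6
  B′ = renF (_↑ˡ 3) B

  σ₁ : Subst 4 m
  σ₁ = subT σ e₁ ∷ₛ σ

  σ₂ : Subst 5 m
  σ₂ = subT σ₁ e₂ ∷ₛ σ₁

  σ₃ : Subst 6 m
  σ₃ = subT σ₂ e₃ ∷ₛ σ₂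

  first : T ⊢ subF σ (set₃ e₁ e₂ e₃ B) ↔ subF σ₁ (set e₂ then set e₃ then B′)
  first = subF-set σ e₁ (set e₂ then set e₃ then B′)

  second : T ⊢ subF σ₁ (set e₂ then set e₃ then B′) ↔ subF σ₂ (set e₃ then B′)
  second = subF-set σ₁ e₂ (set e₃ then B′)

subF-tick : ∀ {T m} (σ : Subst 3 m) B → T ⊢ subF σ (tick B) ↔ subF (next σ) B
subF-tick {T} σ B = subst (T ⊢ subF σ (tick B) ↔_)
  (subF-cong (λ { fz → refl ; (fs fz) → refl ; (fs (fs fz)) → refl }) B)
  (subF-set₃ σ nextZ nextY nextX B)

subF-ticks : ∀ {T m} k (σ : Subst 3 m) B → T ⊢ subF σ (fold B tick k) ↔ subF (fold σ next k) B
subF-ticks zero    σ B = ↔-refl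
subF-ticks {T} (suc k) σ B = ↔-trans (subF-tick σ _)
  -- The outermost tick acts on the state first, whereas `fold` on states adds its outermost update
  -- last.
  (subst (λ τ → T ⊢ subF (next σ) (fold B tick k) ↔ subF τ B) (fold-shift next k σ)
    (subF-ticks k (next σ) B))

-- The sum of `(c + 1) ^ i` for `i < k`, given by the recursion that `nextY` carries out, so that no
-- power or quotient has to be computed.
geom : ℕ → ℕ → ℕ
geom c zero    = 0
geom c (suc k) = suc (geom c k + c * geom c k)

-- One application of `f` adds `c * b + d` to a code `b`, and this increment grows by the factor
-- `suc c` each time.
affine-fold : ∀ c d {f : Formula 3 → Formula 3} → (∀ B → code (f B) ≡ suc c * code B + d) →
              ∀ k B → code (fold B f k) ≡ code B + geom c k * (c * code B + d)
affine-fold c d p zero    B = sym (+-identityʳ _)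
affine-fold c d p (suc k) B = trans (p _) (trans
  (cong (λ x → suc c * x + d) (affine-fold c d p k B)) (lemma c d (code B) (geom c k)))
  where
  lemma : ∀ c d b w → suc c * (b + w * (c * b + d)) + d ≡ b + suc (w + c * w) * (c * b + d)
  lemma = solve-∀

-- The fixed point

module FixedPoint {T : Theory} (Q : ExtendsQ T) (P : Formula 1) (c d : ℕ)
                  (tick-code : ∀ B → code (tick B) ≡ suc c * code B + d) where

  init : Formula 3 → Sentence
  init B = set num c then set 𝟎 then set 𝟎 then B

  start : Subst 3 0
  start = 𝟎 ∷ₛ (𝟎 ∷ₛ (subT v (num c) ∷ₛ v))

  -- In the state `final`, the innermost term has the code of `fold H tick h` as its value, by
  -- `affine-fold`; the three `setCodeT` add the guards of `init`.
  codeT : Term 3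
  codeT = setCodeT {0} (num c) (setCodeT {1} 𝟎 (setCodeT {2} 𝟎
    (v fz ⊕ v (fs fz) ⊗ (v (fs (fs fz)) ⊗ v fz ⊕ num d))))

  H : Formula 3
  H = subF (λ _ → codeT) P

  h : ℕ
  h = code H

  G : Sentence
  G = init (fold H tick h)

  final : Subst 3 0
  final = fold start next h

  e₀ : Fin 0 → ℕ
  e₀ ()

  x-value : ∀ k → evalT (fold start next k fz) e₀ ≡ k
  x-value zero    = refl
  x-value (suc k) = cong suc (x-value k)

  z-value : ∀ k → evalT (fold start next k (fs (fs fz))) e₀ ≡ c
  z-value zero    = trans (cong (λ t → evalT t e₀) (subT-num v c)) (evalT-num c e₀)
  z-value (suc k) = z-value k

  y-value : ∀ k → evalT (fold start next k (fs fz)) e₀ ≡ geom c k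
  y-value zero    = refl
  y-value (suc k) = cong₂ (λ y z → suc (y + z * y)) (y-value k) (z-value k)

  code-value : evalT (subT final codeT) e₀ ≡ code G
  code-value = begin
    evalT (subT final codeT) e₀
      ≡⟨ evalT-sub final e₀ codeT ⟩
    evalT codeT ρ
      ≡⟨ evalT-setCodeT {0} (num c) _ ρ ⟩
    setCode {0} (num c) _
      ≡⟨ cong (setCode {0} (num c)) (trans (evalT-setCodeT {1} 𝟎 _ ρ)
           (cong (setCode {1} 𝟎) (evalT-setCodeT {2} 𝟎 _ ρ))) ⟩
    setCode {0} (num c) (setCode {1} 𝟎 (setCode {2} 𝟎 _))
      ≡⟨ cong (setCode {0} (num c) ∘ setCode {1} 𝟎 ∘ setCode {2} 𝟎)
           (trans body (sym (affine-fold c d tick-code h H))) ⟩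
    setCode {0} (num c) (setCode {1} 𝟎 (setCode {2} 𝟎 (code (fold H tick h))))
      ≡⟨ cong (setCode {0} (num c)) (trans (code-set 𝟎 _) (cong (setCode {1} 𝟎) (code-set 𝟎 _))) ⟨
    setCode {0} (num c) (code {1} (set 𝟎 then set 𝟎 then fold H tick h))
      ≡⟨ code-set (num c) _ ⟨
    code G ∎
    where
    open ≡-Reasoning

    ρ : Fin 3 → ℕ
    ρ i = evalT (final i) e₀

    -- After `h` ticks the counter `x` equals `h`, which is at once the number of iterations and the
    -- code of `H` from which they start.
    body : ρ fz + ρ (fs fz) * (ρ (fs (fs fz)) * ρ fz + evalT (num d) ρ) ≡ h + geom c h * (c * h + d)
    body = cong₂ _+_ (x-value h) (cong₂ _*_ (y-value h)
      (cong₂ _+_ (cong₂ _*_ (z-value h) (x-value h)) (evalT-num d ρ)))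

  init-↔ : ∀ B → T ⊢ init B ↔ subF start B
  init-↔ B = subst (T ⊢_↔ subF start B) (subF-v (init B)) (↔-trans first (↔-trans second third))
    where
    σ₁ : Subst 1 0
    σ₁ = subT v (num c) ∷ₛ v

    first : T ⊢ subF v (init B) ↔ subF σ₁ (set 𝟎 then set 𝟎 then B)
    first = subF-set v (num c) (set 𝟎 then set 𝟎 then B)

    second : T ⊢ subF σ₁ (set 𝟎 then set 𝟎 then B) ↔ subF (𝟎 ∷ₛ σ₁) (set 𝟎 then B)
    second = subF-set σ₁ 𝟎 (set 𝟎 then B)

    third : T ⊢ subF (𝟎 ∷ₛ σ₁) (set 𝟎 then B) ↔ subF start B
    third = subF-set (𝟎 ∷ₛ σ₁) 𝟎 B

  final-H : subF final H ≡ P [ subT final codeT ]₀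
  final-H = trans (subF-subF final _ P) (subF-cong (λ { fz → refl }) P)

  subst-↔ : ∀ {s t} → T ⊢ s ≐ t → T ⊢ P [ s ]₀ ↔ P [ t ]₀
  subst-↔ eq = iff (mp (axSubst P _ _) eq) (mp (axSubst P _ _) (≐-sym eq))

  -- `T` runs `G`: initialisation, then `h` ticks, leaving `P` at a closed term that `T` evaluates
  -- to the numeral of the code of `G`.
  fixed : T ⊢ G ↔ P ⟨ G ⟩
  fixed = subst (λ k → T ⊢ G ↔ P [ num k ]₀) (trans code-value (code≡♯ G))
    (↔-trans (init-↔ (fold H tick h)) (↔-trans (subF-ticks h start H)
    (subst (λ F → T ⊢ F ↔ P [ num (evalT (subT final codeT) e₀) ]₀) (sym final-H)
      (subst-↔ (eval-num Q (subT final codeT) e₀)))))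

diagonal : ∀ {T} → ExtendsQ T → (P : Formula 1) → ∃ λ G → T ⊢ G ↔ P ⟨ G ⟩
diagonal {T} Q P = go tick-affine
  where
  go : (∃₂ λ c d → ∀ B → code (tick B) ≡ suc c * code B + d) → ∃ λ G → T ⊢ G ↔ P ⟨ G ⟩
  go (c , d , p) = FixedPoint.G Q P c d p , FixedPoint.fixed Q P c d p

-- Soundness and Gödelian sentences

theorem1 : (T : Theory) → RecEnum T → ExtendsQ T →
    (Pr : Formula 1) → IsProvPred T Pr →
    D1 T Pr → D2 T Pr → D3 T Pr →
    Sound T ⇔ (∀ G → Godelian T Pr G → True G)
theorem1 T _ Q Pr provable d1 d2 _ = mk⇔ sound⇒true true⇒sound
  where
  sound⇒true : Sound T → ∀ G → Godelian T Pr G → True G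
  -- If `G` were false, `Pr ⟨ G ⟩` would be false too, since otherwise `G` is provable and, by
  -- soundness, true. But the equivalence is itself true, so `G` would follow.
  sound⇒true sound G gödel = Sat-stable G _ λ ¬G →
    sound _ gödel λ _ ¬Pr⇒G → ¬G (¬Pr⇒G λ PrG →
      ¬G (sound G (Equivalence.to (provable G) PrG)))

  Pr-mono : ∀ {A B} → T ⊢ A ⇒ B → T ⊢ Pr ⟨ A ⟩ ⇒ Pr ⟨ B ⟩
  Pr-mono {A} {B} f = mp (d2 A B) (d1 (A ⇒ B) f)

  -- A provable conjunct `σ` leaves `G` unchanged up to provable equivalence, and `Pr-mono` carries
  -- this equivalence under `Pr`.
  conjoin : ∀ {G σ} → T ⊢ σ → T ⊢ G ↔ ¬̇ (Pr ⟨ G ⟩) → Godelian T Pr (G ∧̇ σ)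
  conjoin {G} {σ} ⊢σ G↔¬Pr = ↔⇒⇔̇ (↔-trans G∧σ↔G (↔-trans G↔¬Pr
    (↔-¬ (iff (Pr-mono (from G∧σ↔G)) (Pr-mono (to G∧σ↔G))))))
    where
    G∧σ↔G : T ⊢ G ∧̇ σ ↔ G
    G∧σ↔G = iff ∧-elimˡ (run (ƛ thm ∧-intro · #0 · thm ⊢σ))

  exploit : (∀ G → Godelian T Pr G → True G) → ∀ σ → T ⊢ σ →
            (∃ λ G → T ⊢ G ↔ ¬̇ (Pr ⟨ G ⟩)) → True σ
  exploit true σ ⊢σ (G , G↔¬Pr) =
    -- The conjunction is encoded as `¬̇ (G ⇒ ¬̇ σ)`; if `σ` is false, the inner implication holds,
    -- against the truth of the conjunction.
    Sat-stable σ _ λ ¬σ → true (G ∧̇ σ) (conjoin ⊢σ G↔¬Pr) λ _ → ¬σ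

  true⇒sound : (∀ G → Godelian T Pr G → True G) → Sound T
  true⇒sound true σ ⊢σ = exploit true σ ⊢σ (diagonal Q (¬̇ Pr))
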